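{- Let $\alpha$ be an ordinal, $M,N\in\mathrm{pSh}(\Omega,L)$, $\bar a\in{}^{<\mu}|M|$, $\bar b\in{}^{\mathrm{lh}(\bar a)}|N|$, and let $h:M\to N$ be a partial isomorphism with $h(a_i)=b_i$ for all $i<\mathrm{lh}(\bar a)$ (and so $E\bar a=E\bar b$). Assume $|M|\cap|N|=\emptyset$. Then $h$ shows $(M,\bar a)\sim^{E\bar a}_\alpha(N,\bar b)$ (i.e. $h\in Q_\alpha(E\bar a)$) if and only if player II has a winning strategy for the game $G^\mu_\alpha(M,\bar a,N,\bar b,h)$.
   Context: **Presheaves.** Fix a complete Heyting algebra $\Omega$ (top $\top$) and cardinals $\lambda$, $\mu$. A presheaf $M$ over $\Omega$ is a set $|M|$ of sections with maps $E:|M|\to\Omega$ (extent) and $\upharpoonright:|M|\times\Omega\to|M|$ (restriction) such that $a\upharpoonright Ea=a$, $E(a\upharpoonright p)=Ea\wedge p$, $(a\upharpoonright p)\upharpoonright q=a\upharpoonright(p\wedge q)$. Put $[a=b]_M=\bigvee\{p\le Ea\wedge Eb: a\upharpoonright p=b\upharpoonright p\}$; presheaves are extensional: $Ea=Eb=[a=b]_M$ implies $a=b$. For $p\in\Omega$, $|M\upharpoonright p|=\{a\in|M|:Ea\le p\}$. For a tuple $\bar a=\langle a_i:i<\gamma\rangle$ of sections, $\mathrm{lh}(\bar a)=\gamma$, $E\bar a=\bigwedge_iEa_i$ ($E\emptyset=\top$), $\bar a\upharpoonright p=\langle a_i\upharpoonright p\rangle_i$, $[\bar a=\bar b]_M=\bigwedge_i[a_i=b_i]_M$.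 ${}^{\gamma}X$ (${}^{<\mu}X$) is the set of tuples from $X$ of length $\gamma$ (less than $\mu$). **Structures.** A signature has finitary relation symbols, finitary function symbols and a presheaf over $\Omega$ of constant symbols (so each constant $c$ has an extent $Ec$). An element $M$ of $\mathrm{pSh}(\Omega,L)$ is a presheaf with: for each $n$-ary $R$ a map $R^M:|M|^n\to\Omega$ with $R^M(\bar a)\le E\bar a$ and $[\bar a=\bar b]_M\wedge R^M(\bar a)\le R^M(\bar b)$; for each $n$-ary $f$ a map $f^M:|M|^n\to|M|$ with $Ef^M(\bar a)=E\bar a$ and $[\bar a=\bar b]_M\le[f^M(\bar a)=f^M(\bar b)]_M$; for each constant $c$ a section $\mathfrak c^M$ with $E\mathfrak c^M=Ec$, compatibly with restriction. **Partial isomorphisms.** For $A\subseteq|M|$, $\langle A\rangle=\{a\upharpoonright p:a\in A,p\in\Omega\}$. A partial isomorphism $h:M\to N$ is a bijection $h:A\to B$, $A\subseteq|M|$, $B\subseteq|N|$, with $[a_0=a_1]_M=[h(a_0)=h(a_1)]_N$ on $A$, such that, extending $h$ to $\langle A\rangle$ by $h(a\upharpoonright p)=h(a)\upharpoonright p$ (well defined), for all sections $x,y,x_0,\dots\in\langle A\rangle$: $[x=y]_M=[h(x)=h(y)]_N$; $R^M(x_0,\dots,x_{n-1})=R^N(h(x_0),\dots,h(x_{n-1}))$ for relation symbols $R$; $[x=\mathfrak c^M]_M=[h(x)=\mathfrak c^N]_N$ for constants $c$; $[f^M(x_0,\dots,x_{n-1})=x_n]_M=[f^N(h(x_0),\dots,h(x_{n-1}))=h(x_n)]_N$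 for function symbols $f$. The extended map is also denoted $h$; domains, ranges, values and inclusions below refer to the extended maps; $h_q$ is the restriction of $h$ to sections of extent exactly $q$. **$Q_\alpha(p)$.** $Q_0(p)$ is the class of all partial isomorphisms between elements of $\mathrm{pSh}(\Omega,L)$; $Q_\alpha(p)=\bigcap_{\beta<\alpha}Q_\beta(p)$ for limit $\alpha$; $h:M\to N$ is in $Q_{\beta+1}(p)$ iff $h\in Q_\beta(p)$ and: (Forth) for every $\bar c=\langle c_i:i<\gamma\rangle$, $\gamma<\mu$, from $|M\upharpoonright p|$ there is a set $\{(h_j,q_j,\bar d_j):j\in J\}$ such that for each $j$: $h_j:M\to N$ is in $Q_\beta(q_j)$, $h_{q_j}\subseteq h_j$, $\bar d_j=\langle d_{ji}:i<\gamma\rangle$ is from $|N\upharpoonright E\bar c|$, $E\bar d_j=q_j$, $c_i\upharpoonright q_j\in\mathrm{dom}(h_j)$ and $h_j(c_i\upharpoonright q_j)=d_{ji}$ for all $i<\gamma$; and $\bigvee_jq_j=E\bar c$; (Back) for every $\bar d=\langle d_i:i<\gamma\rangle$, $\gamma<\mu$, from $|N\upharpoonright p|$ there is a set $\{(h_j,q_j,\bar c_j):j\in J\}$ such that for each $j$: $h_j:M\to N$ is in $Q_\beta(q_j)$, $h_{q_j}\subseteq h_j$, $d_i\upharpoonright q_j\in\mathrm{rge}(h_j)$ for all $i$, $\bar c_j=\langle c_{ji}:i<\gamma\rangle$ is from $|M\upharpoonright E\bar d|$, $E\bar c_j=q_j$, $h_j(c_{ji})=d_i\upharpoonright q_j$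 for all $i<\gamma$; and $\bigvee_jq_j=E\bar d$. For $\bar a\in{}^{<\lambda}|M\upharpoonright p|$ and $\bar b\in{}^{\mathrm{lh}(\bar a)}|N\upharpoonright p|$, $(M,\bar a)\sim^p_\alpha(N,\bar b)$ means that the map $a_i\mapsto b_i$ is in $Q_\alpha(p)$. **Game $G^\mu_\alpha(M,\bar a,N,\bar b,h)$.** At move $n$ player I plays $(\bar s_n,\alpha_n)$ with $\bar s_n\in{}^{<\mu}|M|\cup{}^{<\mu}|N|$ and $\alpha_n<\alpha$; player II answers with a set $\{(h_j,q_j,\bar t_j):j\in J_n\}$. At move $0$ player I must ensure $E\bar s_0\le E\bar a$; set $h^*_0=h$. At move $n$ player II must ensure, for each $j\in J_n$: $\bar t_j$ is a tuple of length $\mathrm{lh}(\bar s_n)$ from $|N|$ if $\bar s_n$ is from $|M|$, and from $|M|$ if $\bar s_n$ is from $|N|$; $E\bar t_j=q_j$; $h_j$ is a partial isomorphism with $(h^*_n)_{q_j}\subseteq h_j$; $h_j$ maps $\bar s_n\upharpoonright q_j$ to $\bar t_j$ if $\bar s_n$ is from $|M|$, and maps $\bar t_j$ to $\bar s_n\upharpoonright q_j$ if $\bar s_n$ is from $|N|$; and moreover $E\bar s_n=\bigvee_{j\in J_n}E\bar t_j$. At move $n+1$ player I must choose $\alpha_{n+1}<\alpha_n$, select $j\in J_n$, and ensure $E\bar s_{n+1}\le E\bar t_j$; then $h^*_{n+1}$ is the $h_j$ for this $j$. A player who cannot make a legal move loses and the other player wins.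
   Formalization: In the Forth and Back clauses defining Q, tuples are also required to have extent at most p; this only discards empty tuples (extent ⊤) when p is not ⊤, without which the stated equivalence fails. -}

module Defs where

open import Level using (Level; _⊔_; suc; Lift)
open import Algebra.Core using (Op₂)
open import Data.Fin.Base using (Fin)
open import Data.Nat.Base using (ℕ)
open import Data.Product.Base using (Σ; Σ-syntax; ∃-syntax; _×_)
open import Data.Refinement using (Refinement-syntax; value)
open import Data.Sum.Base using (_⊎_)
open import Function.Base using (_∘_)
open import Function.Bundles using (_⤖_)
open import Induction.WellFounded using (WellFounded)
open import Relation.Binary.Core using (Rel; REL)
open import Relation.Binary.Lattice.Structures using (IsHeytingAlgebra)
open import Relation.Binary.PropositionalEquality.Core using (_≡_)
open import Relation.Binary.Structures using (IsStrictTotalOrder)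
open import Relation.Nullary.Negation.Core using (¬_)

------------------------------------------------------------------------
-- Ordinals and cardinals

record WellOrder (a r : Level) : Set (suc (a ⊔ r)) where
  infix 4 _<_
  field
    Carrier            : Set a
    _<_                : Rel Carrier r
    isStrictTotalOrder : IsStrictTotalOrder _≡_ _<_
    wellFounded        : WellFounded _<_

  IsZero : Carrier → Set (a ⊔ r)
  IsZero α = ∀ β → ¬ (β < α)

  -- IsSuccOf α β means α = β + 1.
  IsSuccOf : Carrier → Carrier → Set (a ⊔ r)
  IsSuccOf α β = β < α × (∀ γ → γ < α → ¬ (β < γ))

  IsLimit : Carrier → Set (a ⊔ r)
  IsLimit α = (∃[ β ] β < α) × (∀ β → β < α → ∃[ γ ] (β < γ × γ < α))

  -- The set of ordinals below γ.  Proofs of i < γ are irrelevant, so that a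
  -- function on Below γ depends on the ordinal i alone.
  Below : Carrier → Set (a ⊔ r)
  Below γ = [ i ∈ Carrier ∣ i < γ ]

-- An ordinal is represented as an element of some well-order: every ordinal α
-- is the element α of the well-order α + 1.  The field classify holds in every
-- well-order by classical logic, and is needed since that is not available.
record Ordinals (a r : Level) : Set (suc (a ⊔ r)) where
  field
    wellOrder : WellOrder a r
  open WellOrder wellOrder public
  field
    classify : ∀ α → IsZero α ⊎ (∃[ β ] IsSuccOf α β) ⊎ IsLimit α

-- A cardinal is an initial ordinal.  The elements of its well-order are the
-- ordinals smaller than it.
record Cardinal (ℓ : Level) : Set (suc ℓ) where
  field
    wellOrder : WellOrder ℓ ℓ
  open WellOrder wellOrder public
  field
    initial : ∀ γ → ¬ (Carrier ⤖ Below γ)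

-- Tuples of length γ, for γ < μ.
Tuple : ∀ {ℓ} (μ : Cardinal ℓ) → Cardinal.Carrier μ → Set ℓ → Set ℓ
Tuple μ γ X = Cardinal.Below μ γ → X

-- Finite tuples; the index set is lifted to the level of the other sets.
Args : ∀ {ℓ} → ℕ → Set ℓ → Set ℓ
Args {ℓ} n X = Lift ℓ (Fin n) → X

------------------------------------------------------------------------
-- Complete Heyting algebras

-- "Set" means a type in Set ℓ with its propositional equality; joins and meets
-- exist for families indexed by any set.
record CompleteHeytingAlgebra (ℓ : Level) : Set (suc ℓ) where
  infix  4 _≤_
  infixr 6 _∨_
  infixr 7 _∧_
  infixr 5 _⇨_
  field
    Carrier          : Set ℓ
    _≤_              : Rel Carrier ℓ
    _∨_ _∧_ _⇨_      : Op₂ Carrier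
    ⊤ ⊥              : Carrier
    isHeytingAlgebra : IsHeytingAlgebra _≡_ _≤_ _∨_ _∧_ _⇨_ ⊤ ⊥
    ⋁ ⋀              : {I : Set ℓ} → (I → Carrier) → Carrier
    ⋁-upper          : {I : Set ℓ} (f : I → Carrier) (i : I) → f i ≤ ⋁ f
    ⋁-least          : {I : Set ℓ} (f : I → Carrier) {x : Carrier} →
                       (∀ i → f i ≤ x) → ⋁ f ≤ x
    ⋀-lower          : {I : Set ℓ} (f : I → Carrier) (i : I) → ⋀ f ≤ f i
    ⋀-greatest       : {I : Set ℓ} (f : I → Carrier) {x : Carrier} →
                       (∀ i → x ≤ f i) → x ≤ ⋀ f

------------------------------------------------------------------------
-- Presheaves, signatures and structures

module _ {ℓ : Level} (Ω : CompleteHeytingAlgebra ℓ) where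

  open CompleteHeytingAlgebra Ω

  record Presheaf : Set (suc ℓ) where
    infixl 8 _↾_
    field
      Section  : Set ℓ
      E        : Section → Carrier
      _↾_      : Section → Carrier → Section
      ↾-extent : ∀ a → a ↾ E a ≡ a
      E-↾      : ∀ a p → E (a ↾ p) ≡ E a ∧ p
      ↾-↾      : ∀ a p q → (a ↾ p) ↾ q ≡ a ↾ (p ∧ q)

    [_≐_] : Section → Section → Carrier
    [ a ≐ b ] = ⋁ {I = Σ[ p ∈ Carrier ] (p ≤ E a ∧ E b × a ↾ p ≡ b ↾ p)} Σ.proj₁

    field
      extensional : ∀ {a b} → E a ≡ E b → E b ≡ [ a ≐ b ] → a ≡ b

    E⃗ : {I : Set ℓ} → (I → Section) → Carrier
    E⃗ a = ⋀ (λ i → E (a i))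

    [_≐⃗_] : {I : Set ℓ} → (I → Section) → (I → Section) → Carrier
    [ a ≐⃗ b ] = ⋀ (λ i → [ a i ≐ b i ])

  record Signature : Set (suc ℓ) where
    field
      RelSym   : Set ℓ
      relArity : RelSym → ℕ
      FunSym   : Set ℓ
      funArity : FunSym → ℕ
      ConSym   : Presheaf

module _ {ℓ : Level} {Ω : CompleteHeytingAlgebra ℓ} where

  open CompleteHeytingAlgebra Ω using (_≤_; _∧_; ⋁) renaming (Carrier to ∣Ω∣)

  record Structure (L : Signature Ω) : Set (suc ℓ) where
    open Signature L
    private module C = Presheaf ConSym
    field
      presheaf : Presheaf Ω
    open Presheaf presheaf public
    field
      rel      : (R : RelSym) → Args (relArity R) Section → ∣Ω∣
      rel-E    : ∀ R a → rel R a ≤ E⃗ a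
      rel-cong : ∀ R a b → [ a ≐⃗ b ] ∧ rel R a ≤ rel R b
      fun      : (f : FunSym) → Args (funArity f) Section → Section
      fun-E    : ∀ f a → E (fun f a) ≡ E⃗ a
      fun-cong : ∀ f a b → [ a ≐⃗ b ] ≤ [ fun f a ≐ fun f b ]
      con      : C.Section → Section
      con-E    : ∀ c → E (con c) ≡ C.E c
      con-↾    : ∀ c p → con (c C.↾ p) ≡ con c ↾ p

  ----------------------------------------------------------------------
  -- Partial isomorphisms

  module _ {L : Signature Ω} where

    -- A bijection h : A → B with A ⊆ |M| and B ⊆ |N| is given by its graph,
    -- of which A is the domain and B the range.  The relation ext is the graph
    -- of the extension of h to ⟨A⟩.
    record PartialIso (M N : Structure L) : Set (suc ℓ) where
      open Signature L
      private
        module M = Structure M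
        module N = Structure N
      field
        graph      : REL M.Section N.Section ℓ
        functional : ∀ {a b b′} → graph a b → graph a b′ → b ≡ b′
        injective  : ∀ {a a′ b} → graph a b → graph a′ b → a ≡ a′
        graph-≐    : ∀ {a₀ a₁ b₀ b₁} → graph a₀ b₀ → graph a₁ b₁ →
                     M.[ a₀ ≐ a₁ ] ≡ N.[ b₀ ≐ b₁ ]

      ext : REL M.Section N.Section ℓ
      ext x y = ∃[ a ] ∃[ b ] ∃[ p ] (graph a b × x ≡ a M.↾ p × y ≡ b N.↾ p)

      field
        ext-≐ : ∀ {x x′ y y′} → ext x x′ → ext y y′ → M.[ x ≐ y ] ≡ N.[ x′ ≐ y′ ]
        rel-≡ : ∀ R {x x′} → (∀ i → ext (x i) (x′ i)) → M.rel R x ≡ N.rel R x′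
        con-≐ : ∀ c {x x′} → ext x x′ → M.[ x ≐ M.con c ] ≡ N.[ x′ ≐ N.con c ]
        fun-≐ : ∀ f {x x′ y y′} → (∀ i → ext (x i) (x′ i)) → ext y y′ →
                M.[ M.fun f x ≐ y ] ≡ N.[ N.fun f x′ ≐ y′ ]

    module _ {M N : Structure L} where

      private
        module M = Structure M
        module N = Structure N

      -- h ∶ x ↦ y says that x ∈ dom h, y ∈ rge h and h(x) = y.
      infix 4 _∶_↦_
      _∶_↦_ : PartialIso M N → M.Section → N.Section → Set ℓ
      h ∶ x ↦ y = PartialIso.ext h x y

      -- h_q ⊆ h′.
      ExtendsAt : ∣Ω∣ → PartialIso M N → PartialIso M N → Set ℓ
      ExtendsAt q h h′ = ∀ {x y} → M.E x ≡ q → h ∶ x ↦ y → h′ ∶ x ↦ y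

  ----------------------------------------------------------------------
  -- The classes Q

  module _ (μ : Cardinal ℓ) {L : Signature Ω} (M N : Structure L) where

    private
      module M = Structure M
      module N = Structure N
      module μ = Cardinal μ

    -- In Forth and Back, a tuple c "from |M ↾ p|" is also required to satisfy
    -- E c ≤ p.  This is automatic unless c is empty, when E c = ⊤: an empty
    -- tuple is then considered only for p = ⊤, where h itself answers it.  For
    -- p ≠ ⊤ it would ask for some h′ in Q_β(⊤), hence about sections outside
    -- M ↾ p, which a game played below p never reaches.

    record Forth {q} (Q : ∣Ω∣ → PartialIso M N → Set q) (h : PartialIso M N)
                 (γ : μ.Carrier) (c : Tuple μ γ M.Section) : Set (suc ℓ ⊔ q) where
      field
        J       : Set ℓ
        h′      : J → PartialIso M N
        q′      : J → ∣Ω∣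
        d       : J → Tuple μ γ N.Section
        inQ     : ∀ j → Q (q′ j) (h′ j)
        extends : ∀ j → ExtendsAt (q′ j) h (h′ j)
        d-from  : ∀ j i → N.E (d j i) ≤ M.E⃗ c
        E-d     : ∀ j → N.E⃗ (d j) ≡ q′ j
        maps    : ∀ j i → h′ j ∶ c i M.↾ q′ j ↦ d j i
        covers  : ⋁ q′ ≡ M.E⃗ c

    record Back {q} (Q : ∣Ω∣ → PartialIso M N → Set q) (h : PartialIso M N)
                (γ : μ.Carrier) (d : Tuple μ γ N.Section) : Set (suc ℓ ⊔ q) where
      field
        J       : Set ℓ
        h′      : J → PartialIso M N
        q′      : J → ∣Ω∣
        c       : J → Tuple μ γ M.Section
        inQ     : ∀ j → Q (q′ j) (h′ j)
        extends : ∀ j → ExtendsAt (q′ j) h (h′ j)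
        c-from  : ∀ j i → M.E (c j i) ≤ N.E⃗ d
        E-c     : ∀ j → M.E⃗ (c j) ≡ q′ j
        maps    : ∀ j i → h′ j ∶ c j i ↦ d i N.↾ q′ j
        covers  : ⋁ q′ ≡ N.E⃗ d

    module _ {o r : Level} (𝕆 : Ordinals o r) where

      private module 𝕆 = Ordinals 𝕆
      open 𝕆 using (_<_)

      -- The three clauses are mutually exclusive, so each of them is an
      -- equivalence for the ordinals α it concerns.
      data Q : 𝕆.Carrier → ∣Ω∣ → PartialIso M N → Set (suc ℓ ⊔ o ⊔ r) where

        Q-zero  : ∀ {α p h} → 𝕆.IsZero α → Q α p h

        Q-suc   : ∀ {α β p h} → 𝕆.IsSuccOf α β → Q β p h →
                  (∀ γ (c : Tuple μ γ M.Section) → (∀ i → M.E (c i) ≤ p) → M.E⃗ c ≤ p →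
                     Forth (Q β) h γ c) →
                  (∀ γ (d : Tuple μ γ N.Section) → (∀ i → N.E (d i) ≤ p) → N.E⃗ d ≤ p →
                     Back (Q β) h γ d) →
                  Q α p h

        Q-limit : ∀ {α p h} → 𝕆.IsLimit α → (∀ β → β < α → Q β p h) → Q α p h

      --------------------------------------------------------------------
      -- The game

      -- The tuple played by player I is tagged by the structure it is from;
      -- this is where |M| ∩ |N| = ∅ enters.
      data Challenge : Set ℓ where
        fromM : ∀ γ → Tuple μ γ M.Section → Challenge
        fromN : ∀ γ → Tuple μ γ N.Section → Challenge

      E-challenge : Challenge → ∣Ω∣
      E-challenge (fromM γ s) = M.E⃗ s
      E-challenge (fromN γ s) = N.E⃗ s

      Response : Challenge → Set ℓ
      Response (fromM γ s) = Tuple μ γ N.Section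
      Response (fromN γ s) = Tuple μ γ M.Section

      E-response : ∀ s → Response s → ∣Ω∣
      E-response (fromM γ s) t = N.E⃗ t
      E-response (fromN γ s) t = M.E⃗ t

      Maps : PartialIso M N → ∣Ω∣ → (s : Challenge) → Response s → Set ℓ
      Maps h q (fromM γ s) t = ∀ i → h ∶ s i M.↾ q ↦ t i
      Maps h q (fromN γ s) t = ∀ i → h ∶ t i ↦ s i N.↾ q

      -- A position with player I to move, after the selection of j if there is
      -- one, is given by the bound e on the extent of the next tuple (E ā at
      -- move 0, then E t̄_j), the bound α on the next ordinal, and h*.
      record LegalMoveI (e : ∣Ω∣) (α : 𝕆.Carrier) : Set (ℓ ⊔ o ⊔ r) where
        field
          s    : Challenge
          α′   : 𝕆.Carrier
          E≤   : E-challenge s ≤ e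
          α′<α : α′ < α

      record LegalMoveII (h* : PartialIso M N) (s : Challenge) : Set (suc ℓ) where
        field
          J       : Set ℓ
          h       : J → PartialIso M N
          q       : J → ∣Ω∣
          t       : J → Response s
          E-t     : ∀ j → E-response s (t j) ≡ q j
          extends : ∀ j → ExtendsAt (q j) h* (h j)
          maps    : ∀ j → Maps (h j) (q j) s (t j)
          covers  : E-challenge s ≡ ⋁ (λ j → E-response s (t j))

      -- A winning strategy for player II from a given position, as the tree of
      -- the plays following it: it has a legal answer to each legal move of
      -- player I, and goes on for each j that player I may select.  Being
      -- inductive, the tree has no infinite branch, so every play following the
      -- strategy ends, with player I unable to move.
      data WinningStrategyII (e : ∣Ω∣) (α : 𝕆.Carrier) (h* : PartialIso M N) :
                             Set (suc ℓ ⊔ o ⊔ r) where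
        strategy :
          ((m : LegalMoveI e α) → let open LegalMoveI m in
             Σ[ a ∈ LegalMoveII h* s ] let open LegalMoveII a in
               (∀ j → WinningStrategyII (E-response s (t j)) α′ (h j))) →
          WinningStrategyII e α h*

      -- Player II has a winning strategy for the game G(M, ā, N, b̄, h) of
      -- length α; its rules do not mention b̄.
      IIWinsGame : 𝕆.Carrier → ∀ {γ} → Tuple μ γ M.Section → Tuple μ γ N.Section →
                   PartialIso M N → Set (suc ℓ ⊔ o ⊔ r)
      IIWinsGame α ā b̄ h = WinningStrategyII (M.E⃗ ā) α h

{-# OPTIONS --safe #-}

-- A winning strategy for player II unfolds by the same recursion on ordinals as
-- Q: answering (s̄ , β) is an instance of Forth or Back for Q β.  Two adjustments
-- are needed.  The game bounds only E s̄, whereas Forth and Back bound the extent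
-- of each section, so a challenge s̄ is answered through s̄ ↾ E s̄.  Conversely,
-- Forth and Back bound the extents of the answering sections, which follows from
-- the rules of the game since partial isomorphisms preserve extents.

module Submission where

open import Defs
open import Level using (Level)
open import Data.Empty using (⊥-elim)
open import Data.Product.Base using (_,_; proj₁)
open import Data.Sum.Base using (inj₁; inj₂)
open import Function.Bundles using (_⇔_; mk⇔)
open import Induction.WellFounded using (Acc; acc)
open import Relation.Binary.Definitions using (tri<; tri≈; tri>)
open import Relation.Binary.Lattice.Structures using (IsHeytingAlgebra)
open import Relation.Binary.PropositionalEquality.Core
  using (_≡_; refl; sym; trans; cong; subst)
open import Relation.Binary.Structures using (IsStrictTotalOrder)

module _ {ℓ} (Ω : CompleteHeytingAlgebra ℓ) where

  open CompleteHeytingAlgebra Ω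
  open IsHeytingAlgebra isHeytingAlgebra
    using (antisym; reflexive; x∧y≤x; x∧y≤y; ∧-greatest)
    renaming (refl to ≤-refl; trans to ≤-trans)

  ⋁-cong : {I : Set ℓ} {f g : I → Carrier} → (∀ i → f i ≡ g i) → ⋁ f ≡ ⋁ g
  ⋁-cong {f = f} {g} f≡g = antisym
    (⋁-least f λ i → ≤-trans (reflexive (f≡g i)) (⋁-upper g i))
    (⋁-least g λ i → ≤-trans (reflexive (sym (f≡g i))) (⋁-upper f i))

  ⋁-upper-≡ : {I : Set ℓ} {f : I → Carrier} {x : Carrier} → ⋁ f ≡ x → ∀ i → f i ≤ x
  ⋁-upper-≡ {f = f} eq i = ≤-trans (⋁-upper f i) (reflexive eq)

  x≤y⇒y∧x≡x : ∀ {x y} → x ≤ y → y ∧ x ≡ x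
  x≤y⇒y∧x≡x x≤y = antisym (x∧y≤y _ _) (∧-greatest x≤y ≤-refl)

  module _ (P : Presheaf Ω) where

    open Presheaf P

    -- The join defining `[ a ≐ a ]` is attained at `p = E a`. Extents thus become instances of
    -- equality values, which partial isomorphisms preserve.
    [a≐a]≡Ea : ∀ a → [ a ≐ a ] ≡ E a
    [a≐a]≡Ea a = antisym
      (⋁-least _ λ (_ , p≤ , _) → ≤-trans p≤ (x∧y≤x _ _))
      (⋁-upper proj₁ (E a , ∧-greatest ≤-refl ≤-refl , refl))

    E-↾-≤ : ∀ a p → E (a ↾ p) ≤ p
    E-↾-≤ a p = ≤-trans (reflexive (E-↾ a p)) (x∧y≤y _ _)

    ↾-↾-≤ : ∀ a {p q} → q ≤ p → (a ↾ p) ↾ q ≡ a ↾ q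
    ↾-↾-≤ a {p} {q} q≤p = trans (↾-↾ a p q) (cong (a ↾_) (x≤y⇒y∧x≡x q≤p))

    -- Lets a challenge be cut down to its joint extent without changing what the answers have to
    -- cover.
    E⃗-↾-E⃗ : {I : Set ℓ} (a : I → Section) → E⃗ (λ i → a i ↾ E⃗ a) ≡ E⃗ a
    E⃗-↾-E⃗ a = antisym
      (⋀-greatest _ λ i → ≤-trans (⋀-lower _ i)
        (≤-trans (reflexive (E-↾ (a i) _)) (x∧y≤x _ _)))
      (⋀-greatest _ λ i → ≤-trans (∧-greatest (⋀-lower _ i) ≤-refl)
        (reflexive (sym (E-↾ (a i) _))))

module _ {ℓ} {Ω : CompleteHeytingAlgebra ℓ} {L : Signature Ω} {M N : Structure L} where

  open CompleteHeytingAlgebra Ω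
  open IsHeytingAlgebra isHeytingAlgebra
    using (reflexive) renaming (trans to ≤-trans)
  private
    module M = Structure M
    module N = Structure N

  -- Apply `ext-≐` to the pair `x`, `y` taken twice.
  ↦⇒E≡ : (h : PartialIso M N) → ∀ {x y} → h ∶ x ↦ y → M.E x ≡ N.E y
  ↦⇒E≡ h {x} {y} x↦y =
    trans (sym ([a≐a]≡Ea Ω M.presheaf x))
      (trans (PartialIso.ext-≐ h x↦y x↦y) ([a≐a]≡Ea Ω N.presheaf y))

  ↾↦⇒E≤ : (h : PartialIso M N) → ∀ {x y q} → h ∶ x M.↾ q ↦ y → N.E y ≤ q
  ↾↦⇒E≤ h {x} {q = q} x↾q↦y =
    ≤-trans (reflexive (sym (↦⇒E≡ h x↾q↦y))) (E-↾-≤ Ω M.presheaf x q)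

  ↦↾⇒E≤ : (h : PartialIso M N) → ∀ {x y q} → h ∶ x ↦ y N.↾ q → M.E x ≤ q
  ↦↾⇒E≤ h {y = y} {q} x↦y↾q =
    ≤-trans (reflexive (↦⇒E≡ h x↦y↾q)) (E-↾-≤ Ω N.presheaf y q)

  module _ (μ : Cardinal ℓ) {o r : Level} (𝕆 : Ordinals o r) where

    private
      module 𝕆 = Ordinals 𝕆
      module < = IsStrictTotalOrder 𝕆.isStrictTotalOrder
    open 𝕆 using (_<_)

    private
      Qₒ : 𝕆.Carrier → Carrier → PartialIso M N → Set _
      Qₒ = Q μ M N 𝕆

      Wins : Carrier → 𝕆.Carrier → PartialIso M N → Set _
      Wins = WinningStrategyII μ M N 𝕆

      Move : PartialIso M N → Challenge μ M N 𝕆 → Set _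
      Move = LegalMoveII μ M N 𝕆

    -- Player I may drop to any `β < α`, while `Q-suc` offers Forth only for the immediate
    -- predecessor. Induction on the derivation of `Qₒ α p h` descends until `β` is that
    -- predecessor.
    Q⇒Forth : ∀ {α β p h} → Qₒ α p h → β < α →
              ∀ γ (c : Tuple μ γ M.Section) → (∀ i → M.E (c i) ≤ p) → M.E⃗ c ≤ p →
              Forth μ M N (Qₒ β) h γ c
    Q⇒Forth (Q-zero 0≡α) β<α = ⊥-elim (0≡α _ β<α)
    Q⇒Forth {β = β} (Q-suc {β = α⁻} (_ , α⁻-max) Qα⁻ forth _) β<α with <.compare β α⁻
    ... | tri< β<α⁻ _ _ = Q⇒Forth Qα⁻ β<α⁻
    ... | tri≈ _ refl _ = forth
    ... | tri> _ _ α⁻<β = ⊥-elim (α⁻-max _ β<α α⁻<β)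
    -- Membership in `Qₒ β` would give Forth only for ordinals below `β`, so some `γ` strictly
    -- between `β` and `α` is used.
    Q⇒Forth (Q-limit (_ , dense) Q<α) β<α with dense _ β<α
    ... | γ , β<γ , γ<α = Q⇒Forth (Q<α γ γ<α) β<γ

    Q⇒Back : ∀ {α β p h} → Qₒ α p h → β < α →
             ∀ γ (d : Tuple μ γ N.Section) → (∀ i → N.E (d i) ≤ p) → N.E⃗ d ≤ p →
             Back μ M N (Qₒ β) h γ d
    Q⇒Back (Q-zero 0≡α) β<α = ⊥-elim (0≡α _ β<α)
    Q⇒Back {β = β} (Q-suc {β = α⁻} (_ , α⁻-max) Qα⁻ _ back) β<α with <.compare β α⁻
    ... | tri< β<α⁻ _ _ = Q⇒Back Qα⁻ β<α⁻
    ... | tri≈ _ refl _ = back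
    ... | tri> _ _ α⁻<β = ⊥-elim (α⁻-max _ β<α α⁻<β)
    Q⇒Back (Q-limit (_ , dense) Q<α) β<α with dense _ β<α
    ... | γ , β<γ , γ<α = Q⇒Back (Q<α γ γ<α) β<γ

    module _ {q} {X : Carrier → PartialIso M N → Set q} {h : PartialIso M N} where

      module _ {γ} (s : Tuple μ γ M.Section)
               (F : Forth μ M N X h γ (λ i → s i M.↾ M.E⃗ s)) where

        open Forth F

        -- Each `q′ j` lies below `M.E⃗ s`, so restricting first to `M.E⃗ s` and then to `q′ j` is
        -- the same as restricting to `q′ j`: an answer to the cut-down tuple also answers `s`.
        Forth-↾⇒LegalMoveII : Move h (fromM γ s)
        Forth-↾⇒LegalMoveII = record
          { J = J ; h = h′ ; q = q′ ; t = d ; E-t = E-d ; extends = extends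
          ; maps = λ j i → subst (h′ j ∶_↦ d j i)
                             (↾-↾-≤ Ω M.presheaf (s i) (⋁-upper-≡ Ω ⋁q′≡Es j))
                             (maps j i)
          ; covers = trans (sym ⋁q′≡Es) (⋁-cong Ω λ j → sym (E-d j))
          }
          where ⋁q′≡Es = trans covers (E⃗-↾-E⃗ Ω M.presheaf s)

      module _ {γ} (s : Tuple μ γ N.Section)
               (B : Back μ M N X h γ (λ i → s i N.↾ N.E⃗ s)) where

        open Back B

        Back-↾⇒LegalMoveII : Move h (fromN γ s)
        Back-↾⇒LegalMoveII = record
          { J = J ; h = h′ ; q = q′ ; t = c ; E-t = E-c ; extends = extends
          ; maps = λ j i → subst (h′ j ∶ c j i ↦_)
                             (↾-↾-≤ Ω N.presheaf (s i) (⋁-upper-≡ Ω ⋁q′≡Es j))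
                             (maps j i)
          ; covers = trans (sym ⋁q′≡Es) (⋁-cong Ω λ j → sym (E-c j))
          }
          where ⋁q′≡Es = trans covers (E⃗-↾-E⃗ Ω N.presheaf s)

      module _ {γ} {s : Tuple μ γ M.Section} (a : Move h (fromM γ s)) where

        open LegalMoveII a renaming (h to h′; q to q′)

        -- For `d-from`, each section of the answer is the image of a restriction to `q′ j`, so its
        -- extent is at most `q′ j`, which is one of the elements joined to give `M.E⃗ s`.
        LegalMoveII⇒Forth : (∀ j → X (q′ j) (h′ j)) → Forth μ M N X h γ s
        LegalMoveII⇒Forth inX = record
          { J = J ; h′ = h′ ; q′ = q′ ; d = t ; inQ = inX ; extends = extends
          ; d-from = λ j i → ≤-trans (↾↦⇒E≤ (h′ j) (maps j i)) (⋁-upper-≡ Ω ⋁q′≡Es j)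
          ; E-d = E-t ; maps = maps ; covers = ⋁q′≡Es
          }
          where ⋁q′≡Es = trans (⋁-cong Ω λ j → sym (E-t j)) (sym covers)

      module _ {γ} {s : Tuple μ γ N.Section} (a : Move h (fromN γ s)) where

        open LegalMoveII a renaming (h to h′; q to q′)

        LegalMoveII⇒Back : (∀ j → X (q′ j) (h′ j)) → Back μ M N X h γ s
        LegalMoveII⇒Back inX = record
          { J = J ; h′ = h′ ; q′ = q′ ; c = t ; inQ = inX ; extends = extends
          ; c-from = λ j i → ≤-trans (↦↾⇒E≤ (h′ j) (maps j i)) (⋁-upper-≡ Ω ⋁q′≡Es j)
          ; E-c = E-t ; maps = maps ; covers = ⋁q′≡Es
          }
          where ⋁q′≡Es = trans (⋁-cong Ω λ j → sym (E-t j)) (sym covers)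

    Q⇒Wins : ∀ {α e h} → Acc _<_ α → Qₒ α e h → Wins e α h
    Q⇒Wins {α} {e} {h} (acc rs) Qα = strategy λ where
      record { s = fromM γ s ; α′ = β ; E≤ = E≤ ; α′<α = β<α } →
        let F = Q⇒Forth Qα β<α γ (λ i → s i M.↾ M.E⃗ s)
                  (λ i → ≤-trans (E-↾-≤ Ω M.presheaf (s i) _) E≤)
                  -- This bound does not follow from the sectionwise one when the tuple is empty.
                  (≤-trans (reflexive (E⃗-↾-E⃗ Ω M.presheaf s)) E≤)
            open Forth F
        in Forth-↾⇒LegalMoveII s F ,
           -- Forth places `h′ j` in the class at `q′ j`, whereas the game continues below the
           -- extent of the answer; `E-d` identifies the two.
           λ j → Q⇒Wins (rs β<α) (subst (λ q → Qₒ β q (h′ j)) (sym (E-d j)) (inQ j))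
      record { s = fromN γ s ; α′ = β ; E≤ = E≤ ; α′<α = β<α } →
        let B = Q⇒Back Qα β<α γ (λ i → s i N.↾ N.E⃗ s)
                  (λ i → ≤-trans (E-↾-≤ Ω N.presheaf (s i) _) E≤)
                  (≤-trans (reflexive (E⃗-↾-E⃗ Ω N.presheaf s)) E≤)
            open Back B
        in Back-↾⇒LegalMoveII s B ,
           λ j → Q⇒Wins (rs β<α) (subst (λ q → Qₒ β q (h′ j)) (sym (E-c j)) (inQ j))

    -- A move legal below `β` is legal below `α`, and the positions after it depend on the chosen
    -- `α′` alone, so the same answers serve.
    Wins-< : ∀ {α β e h} → β < α → Wins e α h → Wins e β h
    Wins-< β<α (strategy answer) = strategy λ where
      record { s = s ; E≤ = E≤ ; α′<α = α′<β } →
        answer record { s = s ; E≤ = E≤ ; α′<α = <.trans α′<β β<α }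

    -- At a successor, Forth and Back are read off from the answers to moves in which player I plays
    -- the predecessor. Membership at smaller ordinals comes from `Wins-<`.
    Wins⇒Q : ∀ {α e h} → Acc _<_ α → Wins e α h → Qₒ α e h
    Wins⇒Q {α} {e} {h} (acc rs) wins@(strategy answer) with 𝕆.classify α
    ... | inj₁ α≡0 = Q-zero α≡0
    ... | inj₂ (inj₂ lim) = Q-limit lim λ β β<α → Wins⇒Q (rs β<α) (Wins-< β<α wins)
    ... | inj₂ (inj₁ (β , α≡β+1@(β<α , _))) =
      Q-suc α≡β+1 (Wins⇒Q (rs β<α) (Wins-< β<α wins))
        (λ γ c _ Ec≤e →
          let a , next = answer record { s = fromM γ c ; E≤ = Ec≤e ; α′<α = β<α }
              open LegalMoveII a renaming (h to h′)
          in LegalMoveII⇒Forth a λ j →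
               subst (λ q → Qₒ β q (h′ j)) (E-t j) (Wins⇒Q (rs β<α) (next j)))
        (λ γ d _ Ed≤e →
          let a , next = answer record { s = fromN γ d ; E≤ = Ed≤e ; α′<α = β<α }
              open LegalMoveII a renaming (h to h′)
          in LegalMoveII⇒Back a λ j →
               subst (λ q → Qₒ β q (h′ j)) (E-t j) (Wins⇒Q (rs β<α) (next j)))

theorem4p2 : {ℓ o r : Level}
    (Ω : CompleteHeytingAlgebra ℓ) (μ : Cardinal ℓ) (L : Signature Ω)
    (𝕆 : Ordinals o r) (α : Ordinals.Carrier 𝕆)
    (M N : Structure L)
    (γ : Cardinal.Carrier μ)
    (ā : Tuple μ γ (Structure.Section M)) (b̄ : Tuple μ γ (Structure.Section N))
    (h : PartialIso M N) →
    (∀ i → h ∶ ā i ↦ b̄ i) →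
    Q μ M N 𝕆 α (Structure.E⃗ M ā) h ⇔ IIWinsGame μ M N 𝕆 α ā b̄ h
theorem4p2 Ω μ L 𝕆 α M N γ ā b̄ h _ = mk⇔ (Q⇒Wins μ 𝕆 wf) (Wins⇒Q μ 𝕆 wf)
  where wf = Ordinals.wellFounded 𝕆 α
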